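{- $\mathsf{LC}$ is sound and complete for finite perfect Kripke models with tree frames: for every modal proposition $A$, $\mathsf{LC}\vdash A$ iff $A$ is forced at every node of every finite perfect Kripke model with tree frame.
   Context: Modal language: propositional variables, $\bot$, $\wedge,\vee,\to$, $\Box$. $\mathsf{iGL}$: intuitionistic propositional logic in the modal language plus $\Box(A\to B)\to(\Box A\to\Box B)$, $\Box A\to\Box\Box A$, $\Box(\Box A\to A)\to\Box A$, closed under modus ponens and necessitation. $\mathsf{LC}:=\mathsf{iGL}+\{A\to\Box A\}$. A Kripke model is $(K,<,\mathcal{R},V)$ with $(K,<)$ a partial order, $\mathcal{R}$ a binary relation with $(\le;\mathcal{R})\subseteq\mathcal{R}$ (composition: $\alpha(R;S)\gamma$ iff $\alpha R\beta S\gamma$ for some $\beta$), $V$ a monotone valuation of variables; forcing is the usual intuitionistic one for $\wedge,\vee,\to,\bot$, and $\alpha\Vdash\Box A$ iff $\beta\Vdash A$ for all $\beta$ with $\alpha\mathcal{R}\beta$. It is perfect if $(\mathcal{R};\le)\subseteq\mathcal{R}$, $\mathcal{R}^{ -1}$ is well-founded and $\mathcal{R}\subseteq<$; finite if $K$ is finite; has a tree frame if $(K,\le)$ is a tree. -}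

module Defs where

open import Data.Empty using () renaming (⊥ to Empty)
open import Data.Fin.Base using (Fin)
open import Data.Nat.Base using (ℕ)
open import Data.Product.Base using (∃; _×_)
open import Data.Sum.Base using (_⊎_)
open import Function.Base using (flip)
open import Function.Bundles using (_↔_)
open import Induction.WellFounded using (WellFounded)
open import Level using (0ℓ)
import Relation.Binary.Construct.StrictToNonStrict as ToNonStrict
open import Relation.Binary.Core using (Rel; _⇒_)
open import Relation.Binary.Definitions using (_Respects_; Minimum)
open import Relation.Binary.PropositionalEquality.Core using (_≡_)
open import Relation.Binary.Structures using (IsStrictPartialOrder)

infix  20 □_
infixr 16 _∧_
infixr 15 _∨_
infixr 14 _⊃_

data Formula : Set where
  var         : ℕ → Formula
  ⊥           : Formula
  _∧_ _∨_ _⊃_ : Formula → Formula → Formula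
  □_          : Formula → Formula

private
  variable
    A B C : Formula
    X     : Formula → Set

infix 4 iGL+_⊢_ LC⊢_

-- `iGL+ X ⊢ A`: A is a theorem of the logic iGL extended by all the
-- formulas in X as further axioms.  There are no open assumptions, so
-- necessitation applies to every derivable formula.
data iGL+_⊢_ (X : Formula → Set) : Formula → Set where
  -- intuitionistic propositional logic
  ax-k  : iGL+ X ⊢ A ⊃ B ⊃ A
  ax-s  : iGL+ X ⊢ (A ⊃ B ⊃ C) ⊃ (A ⊃ B) ⊃ A ⊃ C
  ax-∧ᵢ : iGL+ X ⊢ A ⊃ B ⊃ A ∧ B
  ax-∧₁ : iGL+ X ⊢ A ∧ B ⊃ A
  ax-∧₂ : iGL+ X ⊢ A ∧ B ⊃ B
  ax-∨₁ : iGL+ X ⊢ A ⊃ A ∨ B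
  ax-∨₂ : iGL+ X ⊢ B ⊃ A ∨ B
  ax-∨ₑ : iGL+ X ⊢ (A ⊃ C) ⊃ (B ⊃ C) ⊃ A ∨ B ⊃ C
  ax-⊥  : iGL+ X ⊢ ⊥ ⊃ A
  -- modal axioms
  ax-K  : iGL+ X ⊢ □ (A ⊃ B) ⊃ □ A ⊃ □ B
  ax-4  : iGL+ X ⊢ □ A ⊃ □ □ A
  ax-L  : iGL+ X ⊢ □ (□ A ⊃ A) ⊃ □ A
  -- additional axioms
  ax-X  : X A → iGL+ X ⊢ A
  -- rules
  mp    : iGL+ X ⊢ A ⊃ B → iGL+ X ⊢ A → iGL+ X ⊢ B
  nec   : iGL+ X ⊢ A → iGL+ X ⊢ □ A

data CompletenessAxiom : Formula → Set where
  cp : ∀ A → CompletenessAxiom (A ⊃ □ A)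

LC⊢_ : Formula → Set
LC⊢ A = iGL+ CompletenessAxiom ⊢ A

record KripkeModel : Set₁ where
  infix 4 _<_ _𝓡_
  field
    K                    : Set
    _<_                  : Rel K 0ℓ
    _𝓡_                  : Rel K 0ℓ
    V                    : K → ℕ → Set
    isStrictPartialOrder : IsStrictPartialOrder _≡_ _<_

  open ToNonStrict _≡_ _<_ public using (_≤_)

  field
    ≤-𝓡-comp   : ∀ {α β γ} → α ≤ β → β 𝓡 γ → α 𝓡 γ
    V-monotone : ∀ p → (λ α → V α p) Respects _≤_

  infix 4 _⊩_

  _⊩_ : K → Formula → Set
  α ⊩ var p = V α p
  α ⊩ ⊥     = Empty
  α ⊩ A ∧ B = α ⊩ A × α ⊩ B
  α ⊩ A ∨ B = α ⊩ A ⊎ α ⊩ B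
  α ⊩ A ⊃ B = ∀ β → α ≤ β → β ⊩ A → β ⊩ B
  α ⊩ □ A   = ∀ β → α 𝓡 β → β ⊩ A

module _ (M : KripkeModel) where
  open KripkeModel M

  record Perfect : Set where
    field
      𝓡-≤-comp        : ∀ {α β γ} → α 𝓡 β → β ≤ γ → α 𝓡 γ
      𝓡⁻¹-wellFounded : WellFounded (flip _𝓡_)
      𝓡⊆<             : _𝓡_ ⇒ _<_

  Finite : Set
  Finite = ∃ λ n → K ↔ Fin n

  -- (K , ≤) is a tree: there is a root, and the nodes below any given
  -- node form a chain.  (In general those sets must also be
  -- well-ordered; this is automatic for the finite K considered here.)
  record TreeFrame : Set where
    field
      root     : K
      root-min : Minimum _≤_ root
      ↓-chain  : ∀ {α β γ} → β ≤ α → γ ≤ α → β ≤ γ ⊎ γ ≤ β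

{-# OPTIONS --safe #-}
module Submission where

-- Completeness: call Γ ⊢ C "derivable from hypotheses", with no necessitation of
-- hypotheses.  Over the finite set U of subformulas, either Γ ⊢ C or Γ extends to
-- a theory omitting C that is maximal in U.  An implication A ⊃ B missing from the
-- theory Γ is refuted by a branch for Γ , A ⊬ B, a missing □ A by a branch, entered
-- through a modal edge, for Γ , Γ^□ , □ A ⊬ A, where Γ^□ = {B : □ B ∈ Γ}; Löb's
-- axiom and A ⊃ □ A show that this sequent is underivable whenever Γ ⊬ □ A.  Theories
-- grow strictly along branches, so the search ends with a derivation or a finite tree.
-- Its accessibility relation α 𝓡 β says that the path from α to β uses a modal edge.

open import Defs
open import Function.Bundles using (_⇔_)

open import Data.Bool.Base using (Bool; true; false)
open import Data.Empty using (⊥-elim)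
open import Data.Fin.Base using (Fin)
open import Data.Fin.Properties using (0↔⊥; 1↔⊤; +↔⊎)
open import Data.List.Base using (List; []; _∷_; _++_; filter; length)
open import Data.List.Membership.Propositional using (_∈_; _∉_)
open import Data.List.Membership.Propositional.Properties using (∈-++⁺ˡ; ∈-++⁺ʳ; ∈-++⁻)
import Data.List.Membership.DecPropositional as DecMembership
open import Data.List.Relation.Binary.Subset.Propositional using (_⊆_)
open import Data.List.Relation.Unary.Any using (here; there)
open import Data.Maybe.Base using (Maybe; just; nothing; zipWith)
import Data.Maybe.Base as Maybe
import Data.Nat.Base as ℕ
import Data.Nat.Properties as ℕ
open import Data.Nat.Induction using (<-wellFounded)
open import Data.Product.Base using (∃; ∃-syntax; _×_; _,_; proj₁; proj₂)
open import Data.Sum.Base using (_⊎_; inj₁; inj₂; [_,_]′)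
import Data.Sum.Base as Sum
open import Data.Sum.Function.Propositional using (_⊎-↔_)
open import Data.Unit.Base using (⊤; tt)
open import Function.Base using (id; flip; _∘_)
open import Function.Bundles using (_↔_; mk⇔; mk↔ₛ′; Equivalence)
open import Function.Construct.Composition using (_↔-∘_)
open import Function.Construct.Symmetry using (↔-sym)
open import Induction.WellFounded using (WellFounded; Acc; acc; module Subrelation)
import Relation.Binary.Construct.StrictToNonStrict as ToNonStrict
open import Relation.Binary.Definitions using (DecidableEquality)
open import Relation.Binary.PropositionalEquality
  using (_≡_; refl; cong; cong₂; isEquivalence)
open import Relation.Binary.Structures using (IsStrictPartialOrder; IsPartialOrder)
open import Relation.Nullary using (¬_; yes; no; contradiction)

private
  variable
    A B C F G : Formula
    Γ Δ Θ     : List Formula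
    b         : Bool

-- Soundness over perfect models.

module Soundness (M : KripkeModel) (perfect : Perfect M) where
  open KripkeModel M
  open Perfect perfect
  open IsPartialOrder (ToNonStrict.isPartialOrder _≡_ _<_ isStrictPartialOrder)
    using () renaming (refl to ≤-refl; trans to ≤-trans)

  ⊩-monotone : ∀ A {α β} → α ≤ β → α ⊩ A → β ⊩ A
  ⊩-monotone (var p) α≤β a         = V-monotone p α≤β a
  ⊩-monotone (A ∧ B) α≤β (a , b)   = ⊩-monotone A α≤β a , ⊩-monotone B α≤β b
  ⊩-monotone (A ∨ B) α≤β           = Sum.map (⊩-monotone A α≤β) (⊩-monotone B α≤β)
  ⊩-monotone (A ⊃ B) α≤β f γ β≤γ   = f γ (≤-trans α≤β β≤γ)
  ⊩-monotone (□ A)   α≤β f γ β𝓡γ   = f γ (≤-𝓡-comp α≤β β𝓡γ)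

  𝓡⇒≤ : ∀ {α β} → α 𝓡 β → α ≤ β
  𝓡⇒≤ = inj₁ ∘ 𝓡⊆<

  -- Induction along the converse of `𝓡`. Since `𝓡` is contained in `≤`, a successor `β` inherits
  -- the hypothesis, so the induction gives `□ A` at `β`, and the hypothesis at `β` turns this into
  -- `A`.
  löb : ∀ A {α} → Acc (flip _𝓡_) α → α ⊩ □ (□ A ⊃ A) → α ⊩ □ A
  löb A (acc rs) f β α𝓡β =
    f β α𝓡β β ≤-refl (löb A (rs α𝓡β) λ γ β𝓡γ → f γ (≤-𝓡-comp (𝓡⇒≤ α𝓡β) β𝓡γ))

  sound : LC⊢ A → ∀ α → α ⊩ A
  sound (ax-k {A = A}) _ _ _ a _ β≤γ _ = ⊩-monotone A β≤γ a
  sound ax-s _ _ _ f _ β≤γ g δ γ≤δ a = f δ (≤-trans β≤γ γ≤δ) a δ ≤-refl (g δ γ≤δ a)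
  sound (ax-∧ᵢ {A = A}) _ _ _ a _ β≤γ b = ⊩-monotone A β≤γ a , b
  sound ax-∧₁ _ _ _ = proj₁
  sound ax-∧₂ _ _ _ = proj₂
  sound ax-∨₁ _ _ _ = inj₁
  sound ax-∨₂ _ _ _ = inj₂
  sound ax-∨ₑ _ _ _ f _ β≤γ g δ γ≤δ = [ f δ (≤-trans β≤γ γ≤δ) , g δ γ≤δ ]′
  sound ax-⊥ _ _ _ = ⊥-elim
  sound ax-K _ _ _ f _ β≤γ g δ γ𝓡δ = f δ (≤-𝓡-comp β≤γ γ𝓡δ) δ ≤-refl (g δ γ𝓡δ)
  sound ax-4 _ _ _ f γ β𝓡γ δ γ𝓡δ = f δ (≤-𝓡-comp (𝓡⇒≤ β𝓡γ) γ𝓡δ)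
  sound (ax-L {A = A}) _ β _ = löb A (𝓡⁻¹-wellFounded β)
  -- An `𝓡`-successor lies above in the order, so persistence carries `A` to it.
  sound (ax-X (cp A)) _ _ _ a _ β𝓡γ = ⊩-monotone A (𝓡⇒≤ β𝓡γ) a
  sound (mp p q) α = sound p α α ≤-refl (sound q α)
  sound (nec p) _ β _ = sound p β

-- Derivability from hypotheses.

infix  4 _⊢_
infixl 9 _·_

-- Necessitation is confined to `thm`; this is what makes the deduction theorem hold.
data _⊢_ (Γ : List Formula) : Formula → Set where
  hyp : F ∈ Γ → Γ ⊢ F
  thm : LC⊢ F → Γ ⊢ F
  _·_ : Γ ⊢ F ⊃ G → Γ ⊢ F → Γ ⊢ G

⊢-weaken : Γ ⊆ Δ → Γ ⊢ F → Δ ⊢ F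
⊢-weaken Γ⊆Δ (hyp i) = hyp (Γ⊆Δ i)
⊢-weaken Γ⊆Δ (thm p) = thm p
⊢-weaken Γ⊆Δ (p · q) = ⊢-weaken Γ⊆Δ p · ⊢-weaken Γ⊆Δ q

⊢-closed : [] ⊢ F → LC⊢ F
⊢-closed (thm p) = p
⊢-closed (p · q) = mp (⊢-closed p) (⊢-closed q)

⊢-deduction : F ∷ Γ ⊢ G → Γ ⊢ F ⊃ G
⊢-deduction {F} (hyp (here refl)) = thm (mp (mp ax-s ax-k) (ax-k {B = F}))
⊢-deduction (hyp (there i))       = thm ax-k · hyp i
⊢-deduction (thm p)               = thm (mp ax-k p)
⊢-deduction (p · q)               = thm ax-s · ⊢-deduction p · ⊢-deduction q

-- `ax-K` distributes the box over each modus ponens, so only the hypotheses need boxed versions,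
-- which `σ` supplies.
⊢-□ : (∀ {G} → G ∈ Γ → Δ ⊢ □ G) → Γ ⊢ F → Δ ⊢ □ F
⊢-□ σ (hyp i) = σ i
⊢-□ σ (thm p) = thm (nec p)
⊢-□ σ (p · q) = thm ax-K · ⊢-□ σ p · ⊢-□ σ q

unbox : List Formula → List Formula
unbox []          = []
unbox (□ A ∷ Γ)   = A ∷ unbox Γ
unbox (_ ∷ Γ)     = unbox Γ

-- The catch-all clause of `unbox` computes only once the head connective is known, hence the
-- enumeration of cases.
∈-unbox⁺ : □ A ∈ Γ → A ∈ unbox Γ
∈-unbox⁺ {Γ = _ ∷ _}       (here refl) = here refl
∈-unbox⁺ {Γ = var _ ∷ _}   (there i)   = ∈-unbox⁺ i
∈-unbox⁺ {Γ = ⊥ ∷ _}       (there i)   = ∈-unbox⁺ i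
∈-unbox⁺ {Γ = _ ∧ _ ∷ _}   (there i)   = ∈-unbox⁺ i
∈-unbox⁺ {Γ = _ ∨ _ ∷ _}   (there i)   = ∈-unbox⁺ i
∈-unbox⁺ {Γ = _ ⊃ _ ∷ _}   (there i)   = ∈-unbox⁺ i
∈-unbox⁺ {Γ = □ _ ∷ _}     (there i)   = there (∈-unbox⁺ i)

∈-unbox⁻ : ∀ Γ → A ∈ unbox Γ → □ A ∈ Γ
∈-unbox⁻ (var _ ∷ Γ) i           = there (∈-unbox⁻ Γ i)
∈-unbox⁻ (⊥ ∷ Γ)     i           = there (∈-unbox⁻ Γ i)
∈-unbox⁻ (_ ∧ _ ∷ Γ) i           = there (∈-unbox⁻ Γ i)
∈-unbox⁻ (_ ∨ _ ∷ Γ) i           = there (∈-unbox⁻ Γ i)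
∈-unbox⁻ (_ ⊃ _ ∷ Γ) i           = there (∈-unbox⁻ Γ i)
∈-unbox⁻ (□ _ ∷ Γ)   (here refl) = here refl
∈-unbox⁻ (□ _ ∷ Γ)   (there i)   = there (∈-unbox⁻ Γ i)

-- The deduction theorem leaves `□ A ⊃ A` to be boxed before Löb's axiom applies. Formulas of
-- `unbox Γ` have their boxes in `Γ`; those of `Γ` itself are boxed by `A ⊃ □ A`.
strong-löb : □ A ∷ unbox Γ ++ Γ ⊢ A → Γ ⊢ □ A
strong-löb {Γ = Γ} p = thm ax-L · ⊢-□ boxed (⊢-deduction p)
  where
  boxed : G ∈ unbox Γ ++ Γ → Γ ⊢ □ G
  boxed i with ∈-++⁻ (unbox Γ) i
  ... | inj₁ j = hyp (∈-unbox⁻ Γ j)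
  ... | inj₂ j = thm (ax-X (cp _)) · hyp j

-- Decidable equality of formulas.

-- Returning only positive evidence lets a single clause cover all pairs of distinct connectives.
-- The refutations come from `equal?-refl`: on equal formulas the answer is never `nothing`.
equal? : (A B : Formula) → Maybe (A ≡ B)
equal? (var p) (var q) with p ℕ.≟ q
... | yes p≡q = just (cong var p≡q)
... | no  _   = nothing
equal? ⊥       ⊥       = just refl
equal? (A ∧ B) (C ∧ D) = zipWith (cong₂ _∧_) (equal? A C) (equal? B D)
equal? (A ∨ B) (C ∨ D) = zipWith (cong₂ _∨_) (equal? A C) (equal? B D)
equal? (A ⊃ B) (C ⊃ D) = zipWith (cong₂ _⊃_) (equal? A C) (equal? B D)
equal? (□ A)   (□ B)   = Maybe.map (cong □_) (equal? A B)
equal? _       _       = nothing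

equal?-refl : ∀ A → ∃ λ e → equal? A A ≡ just e
equal?-refl (var p) with p ℕ.≟ p
... | yes _   = _ , refl
... | no  p≢p = contradiction refl p≢p
equal?-refl ⊥       = _ , refl
equal?-refl (A ∧ B) rewrite proj₂ (equal?-refl A) | proj₂ (equal?-refl B) = _ , refl
equal?-refl (A ∨ B) rewrite proj₂ (equal?-refl A) | proj₂ (equal?-refl B) = _ , refl
equal?-refl (A ⊃ B) rewrite proj₂ (equal?-refl A) | proj₂ (equal?-refl B) = _ , refl
equal?-refl (□ A)   rewrite proj₂ (equal?-refl A) = _ , refl

_≟_ : DecidableEquality Formula
A ≟ B with equal? A B in eq
... | just A≡B = yes A≡B
... | nothing  = no λ { refl → unequal (equal?-refl A) }
  where
  unequal : ¬ (∃ λ e → equal? A B ≡ just e)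
  unequal (_ , eq′) rewrite eq with () ← eq′

open DecMembership _≟_ using (_∈?_; _∉?_)

-- Subformulas and the termination measure.

subformulas properSubformulas : Formula → List Formula
subformulas A = A ∷ properSubformulas A
properSubformulas (var _) = []
properSubformulas ⊥       = []
properSubformulas (A ∧ B) = subformulas A ++ subformulas B
properSubformulas (A ∨ B) = subformulas A ++ subformulas B
properSubformulas (A ⊃ B) = subformulas A ++ subformulas B
properSubformulas (□ A)   = subformulas A

SubformulaClosed : List Formula → Set
SubformulaClosed U = ∀ {F} → F ∈ U → properSubformulas F ⊆ U

++-closed : SubformulaClosed Γ → SubformulaClosed Δ → SubformulaClosed (Γ ++ Δ)
++-closed {Γ} cΓ cΔ i with ∈-++⁻ Γ i
... | inj₁ j = ∈-++⁺ˡ ∘ cΓ j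
... | inj₂ j = ∈-++⁺ʳ Γ ∘ cΔ j

∈-++ʳ-subformulas : ∀ A → B ∈ subformulas A ++ subformulas B
∈-++ʳ-subformulas A = ∈-++⁺ʳ (subformulas A) (here refl)

subformulas-closed       : ∀ A → SubformulaClosed (subformulas A)
properSubformulas-closed : ∀ A → SubformulaClosed (properSubformulas A)
subformulas-closed A (here refl) = there
subformulas-closed A (there i)   = there ∘ properSubformulas-closed A i
properSubformulas-closed (A ∧ B) = ++-closed (subformulas-closed A) (subformulas-closed B)
properSubformulas-closed (A ∨ B) = ++-closed (subformulas-closed A) (subformulas-closed B)
properSubformulas-closed (A ⊃ B) = ++-closed (subformulas-closed A) (subformulas-closed B)
properSubformulas-closed (□ A)   = subformulas-closed A

-- The measure on which the search recurses. Repeated entries of `U` are counted repeatedly, which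
-- is harmless because only strict decrease matters.
missing : List Formula → List Formula → ℕ.ℕ
missing U Γ = length (filter (_∉? Γ) U)

missing-antitone : ∀ U → Γ ⊆ Δ → missing U Δ ℕ.≤ missing U Γ
missing-antitone [] Γ⊆Δ = ℕ.z≤n
missing-antitone {Γ} {Δ} (F ∷ U) Γ⊆Δ with F ∈? Γ | F ∈? Δ
... | yes i | yes _ = missing-antitone U Γ⊆Δ
... | yes i | no ¬j = contradiction (Γ⊆Δ i) ¬j
... | no _  | yes _ = ℕ.m≤n⇒m≤1+n (missing-antitone U Γ⊆Δ)
... | no _  | no _  = ℕ.s≤s (missing-antitone U Γ⊆Δ)

missing-decreasing : ∀ U → Γ ⊆ Δ → F ∈ U → F ∉ Γ → F ∈ Δ → missing U Δ ℕ.< missing U Γ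
missing-decreasing {Γ} {Δ} (G ∷ U) Γ⊆Δ (here refl) F∉Γ F∈Δ with G ∈? Γ | G ∈? Δ
... | yes i | _     = contradiction i F∉Γ
... | no _  | yes _ = ℕ.s≤s (missing-antitone U Γ⊆Δ)
... | no _  | no ¬j = contradiction F∈Δ ¬j
missing-decreasing {Γ} {Δ} (G ∷ U) Γ⊆Δ (there F∈U) F∉Γ F∈Δ with G ∈? Γ | G ∈? Δ
... | yes i | yes _ = missing-decreasing U Γ⊆Δ F∈U F∉Γ F∈Δ
... | yes i | no ¬j = contradiction (Γ⊆Δ i) ¬j
... | no _  | yes _ = ℕ.m≤n⇒m≤1+n (missing-decreasing U Γ⊆Δ F∈U F∉Γ F∈Δ)
... | no _  | no _  = ℕ.s≤s (missing-decreasing U Γ⊆Δ F∈U F∉Γ F∈Δ)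

-- Finite labelled forests and their two relations.

-- Each tree of a forest carries a flag telling whether the edge entering its
-- root from below is modal.
data Forest : Set where
  ∅    : Forest
  _∪_  : Forest → Forest → Forest
  node : Bool → List Formula → Forest → Forest

private
  variable
    S T : Forest

data Node : Forest → Set where
  root  : Node (node b Γ S)
  up    : Node S → Node (node b Γ S)
  left  : Node S → Node (S ∪ T)
  right : Node T → Node (S ∪ T)

label : Node S → List Formula
label (root {Γ = Γ}) = Γ
label (up x)         = label x
label (left x)       = label x
label (right x)      = label x

infix 4 _≺_ _↝_

data _≺_ : Node S → Node S → Set where
  root  : {x : Node S} → root {b} {Γ} ≺ up x
  up    : {x y : Node S} → x ≺ y → up {b = b} {Γ = Γ} x ≺ up y
  left  : {x y : Node S} → x ≺ y → left {T = T} x ≺ left y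
  right : {x y : Node T} → x ≺ y → right {S = S} x ≺ right y

-- The path entering the forest from below and ending in x uses a modal edge.
data Modal : Node S → Set where
  root  : Modal (root {true} {Γ} {S})
  below : {x : Node S} → Modal (up {b = true} {Γ} x)
  up    : {x : Node S} → Modal x → Modal (up {b = b} {Γ} x)
  left  : {x : Node S} → Modal x → Modal (left {T = T} x)
  right : {x : Node T} → Modal x → Modal (right {S = S} x)

-- In the case `root`, `Modal` is taken in the forest above that root, so the flag of the edge
-- entering the root does not count: that edge is not on the path.
data _↝_ : Node S → Node S → Set where
  root  : {x : Node S} → Modal x → root {b} {Γ} ↝ up x
  up    : {x y : Node S} → x ↝ y → up {b = b} {Γ = Γ} x ↝ up y
  left  : {x y : Node S} → x ↝ y → left {T = T} x ↝ left y
  right : {x y : Node T} → x ↝ y → right {S = S} x ↝ right y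

≺-irrefl : {x : Node S} → ¬ x ≺ x
≺-irrefl (up p)    = ≺-irrefl p
≺-irrefl (left p)  = ≺-irrefl p
≺-irrefl (right p) = ≺-irrefl p

≺-trans : {x y z : Node S} → x ≺ y → y ≺ z → x ≺ z
≺-trans root      (up q)    = root
≺-trans (up p)    (up q)    = up (≺-trans p q)
≺-trans (left p)  (left q)  = left (≺-trans p q)
≺-trans (right p) (right q) = right (≺-trans p q)

≺-isStrictPartialOrder : IsStrictPartialOrder _≡_ (_≺_ {S})
≺-isStrictPartialOrder = record
  { isEquivalence = isEquivalence
  ; irrefl        = λ { refl → ≺-irrefl }
  ; trans         = ≺-trans
  ; <-resp-≈      = (λ { refl → id }) , (λ { refl → id })
  }

≺-down-linear : {x y z : Node S} → x ≺ z → y ≺ z → x ≺ y ⊎ x ≡ y ⊎ y ≺ x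
≺-down-linear root      root      = inj₂ (inj₁ refl)
≺-down-linear root      (up q)    = inj₁ root
≺-down-linear (up p)    root      = inj₂ (inj₂ root)
≺-down-linear (up p)    (up q)    = Sum.map up (Sum.map (cong up) up) (≺-down-linear p q)
≺-down-linear (left p)  (left q)  = Sum.map left (Sum.map (cong left) left) (≺-down-linear p q)
≺-down-linear (right p) (right q) = Sum.map right (Sum.map (cong right) right) (≺-down-linear p q)

↝⇒≺ : {x y : Node S} → x ↝ y → x ≺ y
↝⇒≺ (root _)  = root
↝⇒≺ (up p)    = up (↝⇒≺ p)
↝⇒≺ (left p)  = left (↝⇒≺ p)
↝⇒≺ (right p) = right (↝⇒≺ p)

modal-≺ : {x y : Node S} → Modal x → x ≺ y → Modal y
modal-≺ root      root      = below
modal-≺ below     (up q)    = below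
modal-≺ (up m)    (up q)    = up (modal-≺ m q)
modal-≺ (left m)  (left q)  = left (modal-≺ m q)
modal-≺ (right m) (right q) = right (modal-≺ m q)

↝⇒modal : {x y : Node S} → x ↝ y → Modal y
↝⇒modal (root m)  = up m
↝⇒modal (up p)    = up (↝⇒modal p)
↝⇒modal (left p)  = left (↝⇒modal p)
↝⇒modal (right p) = right (↝⇒modal p)

-- The path from `x` to `z` contains the path from `y` to `z` and hence its modal edge.
≺-↝-trans : {x y z : Node S} → x ≺ y → y ↝ z → x ↝ z
≺-↝-trans root      (up q)    = root (↝⇒modal q)
≺-↝-trans (up p)    (up q)    = up (≺-↝-trans p q)
≺-↝-trans (left p)  (left q)  = left (≺-↝-trans p q)
≺-↝-trans (right p) (right q) = right (≺-↝-trans p q)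

↝-≺-trans : {x y z : Node S} → x ↝ y → y ≺ z → x ↝ z
↝-≺-trans (root m)  (up q)    = root (modal-≺ m q)
↝-≺-trans (up p)    (up q)    = up (↝-≺-trans p q)
↝-≺-trans (left p)  (left q)  = left (↝-≺-trans p q)
↝-≺-trans (right p) (right q) = right (↝-≺-trans p q)

≻-wellFounded : WellFounded (flip (_≺_ {S}))
≻-wellFounded = accessible
  where
  -- Everything above `up x` is again of the form `up y`, so accessibility transfers from the
  -- smaller forest; likewise for `left` and `right`.
  up-acc : {x : Node S} → Acc (flip _≺_) x → Acc (flip _≺_) (up {b = b} {Γ = Γ} x)
  up-acc (acc rs) = acc λ { (up p) → up-acc (rs p) }
  left-acc : {x : Node S} → Acc (flip _≺_) x → Acc (flip _≺_) (left {T = T} x)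
  left-acc (acc rs) = acc λ { (left p) → left-acc (rs p) }
  right-acc : {x : Node T} → Acc (flip _≺_) x → Acc (flip _≺_) (right {S = S} x)
  right-acc (acc rs) = acc λ { (right p) → right-acc (rs p) }
  accessible : (x : Node S) → Acc (flip _≺_) x
  -- The recursion descends on the implicit forest, as `x` is not a subterm of `root`.
  accessible root      = acc λ { (root {x = x}) → up-acc (accessible x) }
  accessible (up x)    = up-acc (accessible x)
  accessible (left x)  = left-acc (accessible x)
  accessible (right x) = right-acc (accessible x)

Node-finite : ∀ S → ∃ λ n → Node S ↔ Fin n
Node-finite ∅ = 0 , ↔-sym 0↔⊥ ↔-∘ mk↔ₛ′ (λ ()) (λ ()) (λ ()) (λ ())
Node-finite (S ∪ T) with m , f ← Node-finite S | n , g ← Node-finite T =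
  m ℕ.+ n , (↔-sym +↔⊎ ↔-∘ ((f ⊎-↔ g) ↔-∘ split))
  where
  split : Node (S ∪ T) ↔ (Node S ⊎ Node T)
  split = mk↔ₛ′ (λ { (left x) → inj₁ x ; (right x) → inj₂ x }) [ left , right ]′
    (λ { (inj₁ _) → refl ; (inj₂ _) → refl }) (λ { (left _) → refl ; (right _) → refl })
Node-finite (node b Γ S) with n , f ← Node-finite S =
  ℕ.suc n , (↔-sym +↔⊎ ↔-∘ ((↔-sym 1↔⊤ ⊎-↔ f) ↔-∘ split))
  where
  split : Node (node b Γ S) ↔ (⊤ ⊎ Node S)
  split = mk↔ₛ′ (λ { root → inj₁ tt ; (up x) → inj₂ x }) (λ { (inj₁ _) → root ; (inj₂ x) → up x })
    (λ { (inj₁ _) → refl ; (inj₂ _) → refl }) (λ { root → refl ; (up _) → refl })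

-- Saturated labels and valid forests.

-- The clauses that make a label Γ agree with forcing at its node, given the
-- labels I above the node and the labels J that are 𝓡-accessible from it.
Saturated : (Γ : List Formula) (I J : List Formula → Set) → Formula → Set
Saturated Γ I J (var _) = ⊤
Saturated Γ I J ⊥       = ⊥ ∉ Γ
Saturated Γ I J (A ∧ B) = A ∧ B ∈ Γ ⇔ (A ∈ Γ × B ∈ Γ)
Saturated Γ I J (A ∨ B) = A ∨ B ∈ Γ ⇔ (A ∈ Γ ⊎ B ∈ Γ)
Saturated Γ I J (A ⊃ B) =
  (A ⊃ B ∈ Γ → A ∈ Γ → B ∈ Γ) ×
  (A ⊃ B ∈ Γ ⊎ (A ∈ Γ × B ∉ Γ) ⊎ ∃[ Θ ] (I Θ × A ∈ Θ × B ∉ Θ))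
Saturated Γ I J (□ A)   = □ A ∈ Γ ⊎ ∃[ Θ ] (J Θ × A ∉ Θ)

saturated-map : {I J I′ J′ : List Formula → Set} → (∀ {Θ} → I Θ → I′ Θ) → (∀ {Θ} → J Θ → J′ Θ) →
  ∀ F → Saturated Γ I J F → Saturated Γ I′ J′ F
saturated-map f g (var _) s = s
saturated-map f g ⊥       s = s
saturated-map f g (A ∧ B) s = s
saturated-map f g (A ∨ B) s = s
saturated-map f g (A ⊃ B) (s , t) = s , Sum.map₂ (Sum.map₂ λ (Θ , i , r) → Θ , f i , r) t
saturated-map f g (□ A)   s = Sum.map₂ (λ (Θ , j , r) → Θ , g j , r) s

Label ModalLabel : Forest → List Formula → Set
Label S Θ      = ∃[ x ] label {S} x ≡ Θ
ModalLabel S Θ = ∃[ x ] (Modal {S} x × label x ≡ Θ)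

module Completeness (U : List Formula) (U-closed : SubformulaClosed U) where

  -- `Γ` is the label just below the forest. Labels grow along every edge, and a modal edge also
  -- passes on the unboxed formulas.
  data Valid (Γ : List Formula) : Forest → Set where
    ∅    : Valid Γ ∅
    _∪_  : Valid Γ S → Valid Γ T → Valid Γ (S ∪ T)
    node : Γ ⊆ Δ → (b ≡ true → unbox Γ ⊆ Δ) →
           (∀ {F} → F ∈ U → Saturated Δ (Label S) (ModalLabel S) F) →
           Valid Δ S → Valid Γ (node b Δ S)

  below-label : Valid Γ S → (x : Node S) → Γ ⊆ label x
  below-label (node Γ⊆Δ _ _ v) root      = Γ⊆Δ
  below-label (node Γ⊆Δ _ _ v) (up x)    = below-label v x ∘ Γ⊆Δ
  below-label (v ∪ w)          (left x)  = below-label v x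
  below-label (v ∪ w)          (right x) = below-label w x

  below-modal : Valid Γ S → {x : Node S} → Modal x → unbox Γ ⊆ label x
  below-modal (node _ u _ v)   root      = u refl
  below-modal (node _ u _ v)   (below {x = x}) = below-label v x ∘ u refl
  -- The modal edge lies further up, so the boxes of `Γ` are first carried to `Δ` and unboxed there.
  below-modal (node Γ⊆Δ _ _ v) (up m)    = below-modal v m ∘ ∈-unbox⁺ ∘ Γ⊆Δ ∘ ∈-unbox⁻ _
  below-modal (v ∪ w)          (left m)  = below-modal v m
  below-modal (v ∪ w)          (right m) = below-modal w m

  label-≺ : Valid Γ S → {x y : Node S} → x ≺ y → label x ⊆ label y
  label-≺ (node _ _ _ v) (root {x = x}) = below-label v x
  label-≺ (node _ _ _ v) (up p)    = label-≺ v p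
  label-≺ (v ∪ w)        (left p)  = label-≺ v p
  label-≺ (v ∪ w)        (right p) = label-≺ w p

  label-↝ : Valid Γ S → {x y : Node S} → x ↝ y → unbox (label x) ⊆ label y
  label-↝ (node _ _ _ v) (root m)  = below-modal v m
  label-↝ (node _ _ _ v) (up p)    = label-↝ v p
  label-↝ (v ∪ w)        (left p)  = label-↝ v p
  label-↝ (v ∪ w)        (right p) = label-↝ w p

  -- Validity saturates each node relative to the forest directly above it. Embedding that forest
  -- into the whole preserves the witnesses.
  saturated : Valid Γ S → (x : Node S) → F ∈ U →
    Saturated (label x) (λ Θ → ∃[ y ] (x ≺ y × label y ≡ Θ)) (λ Θ → ∃[ y ] (x ↝ y × label y ≡ Θ)) F
  saturated (node _ _ s v) root i =
    saturated-map (λ (y , e) → up y , root , e) (λ (y , m , e) → up y , root m , e) _ (s i)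
  saturated (node _ _ _ v) (up x) i =
    saturated-map (λ (y , p , e) → up y , up p , e) (λ (y , p , e) → up y , up p , e) _ (saturated v x i)
  saturated (v ∪ w) (left x) i =
    saturated-map (λ (y , p , e) → left y , left p , e) (λ (y , p , e) → left y , left p , e) _ (saturated v x i)
  saturated (v ∪ w) (right x) i =
    saturated-map (λ (y , p , e) → right y , right p , e) (λ (y , p , e) → right y , right p , e) _ (saturated w x i)

  -- The model on a valid forest and the truth lemma.

  forestModel : Valid Γ S → KripkeModel
  forestModel {S = S} v = record
    { K                    = Node S
    ; _<_                  = _≺_
    ; _𝓡_                  = _↝_
    ; V                    = λ x p → var p ∈ label x
    ; isStrictPartialOrder = ≺-isStrictPartialOrder
    ; ≤-𝓡-comp             = λ { (inj₁ p) q → ≺-↝-trans p q ; (inj₂ refl) q → q }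
    ; V-monotone           = λ { _ (inj₁ p) → label-≺ v p ; _ (inj₂ refl) → id }
    }

  forestModel-perfect : (v : Valid Γ S) → Perfect (forestModel v)
  forestModel-perfect v = record
    { 𝓡-≤-comp        = λ { p (inj₁ q) → ↝-≺-trans p q ; p (inj₂ refl) → p }
    ; 𝓡⁻¹-wellFounded = Subrelation.wellFounded ↝⇒≺ ≻-wellFounded
    ; 𝓡⊆<             = ↝⇒≺
    }

  forestModel-tree : (v : Valid Γ (node b Δ S)) → TreeFrame (forestModel v)
  forestModel-tree v = record
    { root     = root
    ; root-min = λ { root → inj₂ refl ; (up x) → inj₁ root }
    ; ↓-chain  = chain
    }
    where
    open KripkeModel (forestModel v) using (_≤_)
    chain : ∀ {x y z} → y ≤ x → z ≤ x → y ≤ z ⊎ z ≤ y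
    chain (inj₂ refl) q           = inj₂ q
    chain p           (inj₂ refl) = inj₁ p
    chain (inj₁ p)    (inj₁ q) with ≺-down-linear p q
    ... | inj₁ y≺z        = inj₁ (inj₁ y≺z)
    ... | inj₂ (inj₁ y≡z) = inj₁ (inj₂ y≡z)
    ... | inj₂ (inj₂ z≺y) = inj₂ (inj₁ z≺y)

  module _ (v : Valid Γ S) where
    open KripkeModel (forestModel v)

    -- Both directions are proved together because an implication uses the converse for its
    -- antecedent. Membership passes upward by growth of labels; non-membership has a witness by
    -- saturation.
    truth : ∀ F → F ∈ U → (x : Node S) → (F ∈ label x → x ⊩ F) × (x ⊩ F → F ∈ label x)
    truth (var _) i x = id , id
    truth ⊥       i x = saturated v x i , λ ()
    truth (A ∧ B) i x with truth A (U-closed i (here refl)) x | truth B (U-closed i (∈-++ʳ-subformulas A)) x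
    ... | fA , tA | fB , tB = (λ j → let a , b = to j in fA a , fB b) , λ (a , b) → from (tA a , tB b)
      where open Equivalence (saturated v x i)
    truth (A ∨ B) i x with truth A (U-closed i (here refl)) x | truth B (U-closed i (∈-++ʳ-subformulas A)) x
    ... | fA , tA | fB , tB = (λ j → Sum.map fA fB (to j)) , λ s → from (Sum.map tA tB s)
      where open Equivalence (saturated v x i)
    truth (A ⊃ B) i x = force , member
      where
      iA = U-closed i (here refl)
      iB = U-closed i (∈-++ʳ-subformulas A)
      step : ∀ y → A ⊃ B ∈ label y → y ⊩ A → y ⊩ B
      step y j a = proj₁ (truth B iB y) (proj₁ (saturated v y i) j (proj₂ (truth A iA y) a))
      force : A ⊃ B ∈ label x → x ⊩ A ⊃ B
      force j y (inj₁ x≺y)  = step y (label-≺ v x≺y j)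
      force j y (inj₂ refl) = step y j
      member : x ⊩ A ⊃ B → A ⊃ B ∈ label x
      member f with proj₂ (saturated v x i)
      ... | inj₁ j = j
      ... | inj₂ (inj₁ (a , ¬b)) =
        contradiction (proj₂ (truth B iB x) (f x (inj₂ refl) (proj₁ (truth A iA x) a))) ¬b
      ... | inj₂ (inj₂ (_ , (y , x≺y , refl) , a , ¬b)) =
        contradiction (proj₂ (truth B iB y) (f y (inj₁ x≺y) (proj₁ (truth A iA y) a))) ¬b
    truth (□ A) i x = (λ j y x↝y → proj₁ (truth A iA y) (label-↝ v x↝y (∈-unbox⁺ j))) , member
      where
      iA = U-closed i (here refl)
      member : x ⊩ □ A → □ A ∈ label x
      member f with saturated v x i
      ... | inj₁ j = j
      ... | inj₂ (_ , (y , x↝y , refl) , ¬a) = contradiction (proj₂ (truth A iA y) (f y x↝y)) ¬a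

  -- Search for a derivation or a counterexample.

  -- A refuting node without its entering edge: whoever attaches it chooses the flag.
  record Counterexample (Γ : List Formula) (C : Formula) : Set where
    field
      theory    : List Formula
      branches  : Forest
      Γ⊆theory  : Γ ⊆ theory
      C∉theory  : C ∉ theory
      isSat     : ∀ {F} → F ∈ U → Saturated theory (Label branches) (ModalLabel branches) F
      isValid   : Valid theory branches

  weakenCounterexample : Γ ⊆ Δ → Counterexample Δ C → Counterexample Γ C
  weakenCounterexample Γ⊆Δ c = record { Counterexample c ; Γ⊆theory = Counterexample.Γ⊆theory c ∘ Γ⊆Δ }

  Decided : List Formula → Formula → Set
  Decided Γ C = Γ ⊢ C ⊎ Counterexample Γ C

  Expansion : List Formula → (Formula → Set) → Set
  Expansion Γ P = ∃[ S ] (Valid Γ S × (∀ {F} → P F → Saturated Γ (Label S) (ModalLabel S) F))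

  -- Saturation clauses use the labels above only as a supply of witnesses, so forests built for
  -- single formulas can be put side by side.
  gather : ∀ {D : Set} Fs → (∀ {F} → F ∈ Fs → D ⊎ Expansion Γ (_≡ F)) → D ⊎ Expansion Γ (_∈ Fs)
  gather [] f = inj₂ (∅ , ∅ , λ ())
  gather (F ∷ Fs) f with f (here refl) | gather Fs (f ∘ there)
  ... | inj₁ d | _      = inj₁ d
  ... | inj₂ _ | inj₁ d = inj₁ d
  ... | inj₂ (S , v , s) | inj₂ (T , w , t) = inj₂ (S ∪ T , v ∪ w , λ
    { (here refl) → saturated-map (λ (x , e) → left x , e) (λ (x , m , e) → left x , left m , e) F (s refl)
    ; (there i)   → saturated-map (λ (x , e) → right x , e) (λ (x , m , e) → right x , right m , e) _ (t i) })

  -- `decided` is maximality of `Γ` in `U` relative to `C`. `search` is the recursive call,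
  -- restricted to lists that gain a formula of `U`.
  module Expand (Γ : List Formula) (C : Formula)
    (decided : ∀ {F} → F ∈ U → F ∈ Γ ⊎ Γ ⊢ F ⊃ C)
    (search : ∀ Δ D → Γ ⊆ Δ → (∃[ F ] (F ∈ U × F ∉ Γ × F ∈ Δ)) → Decided Δ D) where

    leaf : (∀ {I J} → Saturated Γ I J F) → Γ ⊢ C ⊎ Expansion Γ (_≡ F)
    leaf s = inj₂ (∅ , ∅ , λ { refl → s })

    deriveOrMember : F ∈ U → Γ ⊢ F → Γ ⊢ C ⊎ F ∈ Γ
    deriveOrMember i p with decided i
    ... | inj₁ j = inj₂ j
    ... | inj₂ q = inj₁ (q · p)

    discharge : F ∈ U → F ∉ Γ → Γ ⊢ F → Γ ⊢ C
    discharge i F∉Γ p with decided i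
    ... | inj₁ j = contradiction j F∉Γ
    ... | inj₂ q = q · p

    expand : ∀ F → F ∈ U → Γ ⊢ C ⊎ Expansion Γ (_≡ F)
    expand (var p) i = leaf tt
    expand ⊥ i with ⊥ ∈? Γ
    ... | yes j = inj₁ (thm ax-⊥ · hyp j)
    ... | no ¬j = leaf ¬j
    expand (A ∧ B) i with A ∧ B ∈? Γ
    ... | yes j with deriveOrMember (U-closed i (here refl)) (thm ax-∧₁ · hyp j)
                   | deriveOrMember (U-closed i (∈-++ʳ-subformulas A)) (thm ax-∧₂ · hyp j)
    ...   | inj₁ d | _      = inj₁ d
    ...   | inj₂ _ | inj₁ d = inj₁ d
    ...   | inj₂ a | inj₂ b = leaf (mk⇔ (λ _ → a , b) λ _ → j)
    expand (A ∧ B) i | no ¬j with A ∈? Γ | B ∈? Γ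
    ...   | no ¬a | _     = leaf (mk⇔ (⊥-elim ∘ ¬j) (⊥-elim ∘ ¬a ∘ proj₁))
    ...   | yes _ | no ¬b = leaf (mk⇔ (⊥-elim ∘ ¬j) (⊥-elim ∘ ¬b ∘ proj₂))
    ...   | yes a | yes b = inj₁ (discharge i ¬j (thm ax-∧ᵢ · hyp a · hyp b))
    expand (A ∨ B) i with A ∨ B ∈? Γ
    ... | yes j with decided (U-closed i (here refl)) | decided (U-closed i (∈-++ʳ-subformulas A))
    ...   | inj₁ a | _      = leaf (mk⇔ (λ _ → inj₁ a) λ _ → j)
    ...   | inj₂ _ | inj₁ b = leaf (mk⇔ (λ _ → inj₂ b) λ _ → j)
    -- Primeness: if both disjuncts were left out, each yields `C`, hence so does the disjunction.
    ...   | inj₂ p | inj₂ q = inj₁ (thm ax-∨ₑ · p · q · hyp j)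
    expand (A ∨ B) i | no ¬j with A ∈? Γ | B ∈? Γ
    ...   | no ¬a | no ¬b = leaf (mk⇔ (⊥-elim ∘ ¬j) (⊥-elim ∘ [ ¬a , ¬b ]′))
    ...   | yes a | _     = inj₁ (discharge i ¬j (thm ax-∨₁ · hyp a))
    expand (A ∨ B) i | no ¬j | no _  | yes b = inj₁ (discharge i ¬j (thm ax-∨₂ · hyp b))
    expand (A ⊃ B) i with A ⊃ B ∈? Γ | A ∈? Γ
    ... | yes j | no ¬a = leaf ((λ _ a → contradiction a ¬a) , inj₁ j)
    ... | yes j | yes a with deriveOrMember (U-closed i (∈-++ʳ-subformulas A)) (hyp j · hyp a)
    ...   | inj₁ d = inj₁ d
    ...   | inj₂ b = leaf ((λ _ _ → b) , inj₁ j)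
    -- Adding `A` would gain nothing here; the theory itself has to refute the implication.
    expand (A ⊃ B) i | no ¬j | yes a with B ∈? Γ
    ...   | no ¬b = leaf ((λ j → contradiction j ¬j) , inj₂ (inj₁ (a , ¬b)))
    ...   | yes b = inj₁ (discharge i ¬j (thm ax-k · hyp b))
    expand (A ⊃ B) i | no ¬j | no ¬a
      with search (A ∷ Γ) B there (A , U-closed i (here refl) , ¬a , here refl)
    ...   | inj₁ p = inj₁ (discharge i ¬j (⊢-deduction p))
    expand (A ⊃ B) i | no ¬j | no ¬a | inj₂ c = inj₂
      ( node false theory branches
      , node (Γ⊆theory ∘ there) (λ ()) isSat isValid
      , λ { refl → (λ j → contradiction j ¬j)
                 , inj₂ (inj₂ (theory , (root , refl) , Γ⊆theory (here refl) , C∉theory)) })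
      where open Counterexample c
    expand (□ A) i with □ A ∈? Γ
    ... | yes j = leaf (inj₁ j)
    -- The gained formula is `□ A`, the extra hypothesis granted by Löb's axiom; `A` itself may
    -- already be in `Γ`.
    ... | no ¬j with search (□ A ∷ unbox Γ ++ Γ) A (there ∘ ∈-++⁺ʳ (unbox Γ)) (□ A , i , ¬j , here refl)
    ...   | inj₁ p = inj₁ (discharge i ¬j (strong-löb p))
    expand (□ A) i | no ¬j | inj₂ c = inj₂
      ( node true theory branches
      , node (Γ⊆theory ∘ there ∘ ∈-++⁺ʳ (unbox Γ)) (λ _ → Γ⊆theory ∘ there ∘ ∈-++⁺ˡ) isSat isValid
      , λ { refl → inj₂ (theory , (root , root , refl) , C∉theory) })
      where open Counterexample c

    complete : Decided Γ C
    complete with C ∈? Γ | gather U (expand _)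
    ... | yes j | _                  = inj₁ (hyp j)
    ... | no _  | inj₁ d             = inj₁ d
    ... | no ¬j | inj₂ (S , v , sat) = inj₂ record
      { theory = Γ ; branches = S ; Γ⊆theory = id ; C∉theory = ¬j ; isSat = sat ; isValid = v }

  -- Lindenbaum's construction over U: a formula is left out of the theory only
  -- when adding it is found to yield C.
  lindenbaum : ∀ Γ C → (∀ Δ D → missing U Δ ℕ.< missing U Γ → Decided Δ D) →
    ∀ todo Δ → Γ ⊆ Δ → (∀ {F} → F ∈ U → F ∈ todo ⊎ F ∈ Δ ⊎ Δ ⊢ F ⊃ C) → Decided Δ C
  lindenbaum Γ C search [] Δ Γ⊆Δ inv = Expand.complete Δ C (λ i → [ (λ ()) , id ]′ (inv i))
    λ Θ D Δ⊆Θ (F , F∈U , F∉Δ , F∈Θ) →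
      search Θ D (missing-decreasing U (Δ⊆Θ ∘ Γ⊆Δ) F∈U (F∉Δ ∘ Γ⊆Δ) F∈Θ)
  lindenbaum Γ C search (F ∷ todo) Δ Γ⊆Δ inv
    with lindenbaum Γ C search todo (F ∷ Δ) (there ∘ Γ⊆Δ) with-F
    where
    with-F : G ∈ U → G ∈ todo ⊎ G ∈ F ∷ Δ ⊎ F ∷ Δ ⊢ G ⊃ C
    with-F i with inv i
    ... | inj₁ (here e)  = inj₂ (inj₁ (here e))
    ... | inj₁ (there j) = inj₁ j
    ... | inj₂ s         = inj₂ (Sum.map there (⊢-weaken there) s)
  ... | inj₂ c = inj₂ (weakenCounterexample there c)
  ... | inj₁ p = lindenbaum Γ C search todo Δ Γ⊆Δ without-F
    where
    without-F : G ∈ U → G ∈ todo ⊎ G ∈ Δ ⊎ Δ ⊢ G ⊃ C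
    without-F i with inv i
    ... | inj₁ (here refl) = inj₂ (inj₂ (⊢-deduction p))
    ... | inj₁ (there j)   = inj₁ j
    ... | inj₂ s           = inj₂ s

  decide : ∀ Γ C → Acc ℕ._<_ (missing U Γ) → Decided Γ C
  -- Initially every formula of `U` is pending, so `inj₁` proves the invariant.
  decide Γ C (acc rs) = lindenbaum Γ C (λ Δ D lt → decide Δ D (rs lt)) U Γ id inj₁

-- Soundness and completeness combined.

theorem4p25 : (A : Formula) →
    (LC⊢ A) ⇔ ((M : KripkeModel) → Finite M → Perfect M → TreeFrame M →
    (α : KripkeModel.K M) → KripkeModel._⊩_ M α A)
theorem4p25 A = mk⇔ (λ p M _ perfect _ → Soundness.sound M perfect p) complete
  where
  open Completeness (subformulas A) (subformulas-closed A)
  complete : _ → LC⊢ A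
  complete forced with decide [] A (<-wellFounded _)
  ... | inj₁ p = ⊢-closed p
  ... | inj₂ c = contradiction
    (proj₂ (truth v A (here refl) root)
      (forced (forestModel v) (Node-finite _) (forestModel-perfect v) (forestModel-tree v) root))
    C∉theory
    where
    open Counterexample c
    -- The root of the tree has no edge below it, so its flag is a default value.
    v : Valid [] (node false theory branches)
    v = node (λ ()) (λ ()) isSat isValid
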